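{- There is a function $\varepsilon(n)\to 0$ (as $n\to\infty$) such that, for the random graph $G\sim G(n,1/2)$, $$\Pr\left[\pi(G)\le n^{(1+\varepsilon(n))\log_2 n}\right]\to 1\quad\text{as } n\to\infty .$$
   Context: $G(n,1/2)$ is the random graph on $n$ labelled vertices in which each of the $\binom n2$ possible edges is present independently with probability $1/2$. $k(G)$ is the number of cliques of $G$ (vertex subsets inducing a complete subgraph) and $i(G)$ is the number of independent sets of $G$; the empty set and all singletons count both as cliques and as independent sets. $\pi(G)=i(G)\,k(G)$. -}

module Defs where

import Algebra.Definitions.RawSemiring
open import Data.Bool.Base using (Bool; true; false; if_then_else_)
import Data.Bool.Properties as Bool
open import Data.Fin.Base using (Fin; zero; suc)
import Data.Fin.Properties as Fin
open import Data.Fin.Subset using (Subset; _∈_)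
open import Data.Fin.Subset.Properties using (_∈?_)
open import Data.Integer.Base as ℤ using (ℤ; +_; -[1+_])
open import Data.List.Base as List using (List; []; _∷_; length; filter; cartesianProductWith)
open import Data.Nat.Base as ℕ using (ℕ; zero; suc)
open import Data.Product.Base using (∃; ∃-syntax; _×_; _,_)
open import Data.Rational.Base
  using (ℚ; 0ℚ; 1ℚ; _+_; _*_; _-_; _⊓_; _⊔_; _<_; _≤_; _/_; ↥_; ↧ₙ_; +-*-rawSemiring)
open import Data.Sum.Base using (_⊎_)
open import Data.Vec.Base as Vec using (Vec; []; _∷_; lookup)
open import Function.Bundles using (_⇔_)
open import Relation.Binary.PropositionalEquality.Core using (_≡_; _≢_; refl)
open import Relation.Nullary using (¬_; Dec; ¬?; _→-dec_)

open Algebra.Definitions.RawSemiring +-*-rawSemiring using (_^_)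

------------------------------------------------------------------------
-- Labelled graphs

-- A graph on vertices 0, …, n-1, stored as one bit for each of the
-- n(n-1)/2 pairs: in `r ∷ g`, `r` lists the adjacencies of vertex 0 to
-- the vertices 1, 2, …, and `g` is the graph induced on the latter.
data Graph : ℕ → Set where
  []  : Graph zero
  _∷_ : ∀ {n} → Vec Bool n → Graph n → Graph (suc n)

adj : ∀ {n} → Graph n → Fin n → Fin n → Bool
adj (r ∷ g) zero    zero    = false
adj (r ∷ g) zero    (suc j) = lookup r j
adj (r ∷ g) (suc i) zero    = lookup r i
adj (r ∷ g) (suc i) (suc j) = adj g i j

adj-irrefl : ∀ {n} (g : Graph n) i → adj g i i ≡ false
adj-irrefl (r ∷ g) zero    = refl
adj-irrefl (r ∷ g) (suc i) = adj-irrefl g i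

adj-sym : ∀ {n} (g : Graph n) i j → adj g i j ≡ adj g j i
adj-sym (r ∷ g) zero    zero    = refl
adj-sym (r ∷ g) zero    (suc j) = refl
adj-sym (r ∷ g) (suc i) zero    = refl
adj-sym (r ∷ g) (suc i) (suc j) = adj-sym g i j

IsClique : ∀ {n} → Graph n → Subset n → Set
IsClique g s = ∀ i → i ∈ s → ∀ j → j ∈ s → i ≢ j → adj g i j ≡ true

IsIndependent : ∀ {n} → Graph n → Subset n → Set
IsIndependent g s = ∀ i → i ∈ s → ∀ j → j ∈ s → i ≢ j → adj g i j ≡ false

private
  pairwise? : ∀ {n} (g : Graph n) (b : Bool) (s : Subset n) →
              Dec (∀ i → i ∈ s → ∀ j → j ∈ s → i ≢ j → adj g i j ≡ b)
  pairwise? g b s =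
    Fin.all? λ i → (i ∈? s) →-dec (Fin.all? λ j → (j ∈? s) →-dec
      (¬? (i Fin.≟ j) →-dec (adj g i j Bool.≟ b)))

isClique? : ∀ {n} (g : Graph n) (s : Subset n) → Dec (IsClique g s)
isClique? g = pairwise? g true

isIndependent? : ∀ {n} (g : Graph n) (s : Subset n) → Dec (IsIndependent g s)
isIndependent? g = pairwise? g false

-- All bit vectors of length n, each once; as `Subset n` is `Vec Bool n`,
-- this also lists all subsets of the vertex set.
bitVecs : ∀ n → List (Vec Bool n)
bitVecs zero    = [] ∷ []
bitVecs (suc n) = cartesianProductWith _∷_ (true ∷ false ∷ []) (bitVecs n)

k : ∀ {n} → Graph n → ℕ
k {n} g = length (filter (isClique? g) (bitVecs n))

i : ∀ {n} → Graph n → ℕ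
i {n} g = length (filter (isIndependent? g) (bitVecs n))

π : ∀ {n} → Graph n → ℕ
π g = i g ℕ.* k g

------------------------------------------------------------------------
-- Real numbers as Dedekind cuts of ℚ

-- `lower q` is read "q is less than the number", `upper q` "the number
-- is less than q".  The operations below are given on bare pairs of
-- predicates; on Dedekind cuts they are the usual real operations.
record Cut : Set₁ where
  field
    lower upper : ℚ → Set

open Cut public

record IsDedekind (x : Cut) : Set where
  field
    lower-inhabited : ∃[ q ] lower x q
    upper-inhabited : ∃[ q ] upper x q
    lower-rounded   : ∀ q → lower x q ⇔ (∃[ r ] q < r × lower x r)
    upper-rounded   : ∀ q → upper x q ⇔ (∃[ r ] r < q × upper x r)
    disjoint        : ∀ q → ¬ (lower x q × upper x q)
    located         : ∀ q r → q < r → lower x q ⊎ upper x r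

record ℝ : Set₁ where
  field
    cut        : Cut
    isDedekind : IsDedekind cut

open ℝ public

fromℚ : ℚ → Cut
fromℚ p .lower q = q < p
fromℚ p .upper q = p < q

fromℕ : ℕ → Cut
fromℕ m = fromℚ (+ m / 1)

infix 4 _<ᶜ_ _≤ᶜ_
infixl 6 _+ᶜ_
infixl 7 _*ᶜ_
infixr 8 _^ᶜ_

_<ᶜ_ : Cut → Cut → Set
x <ᶜ y = ∃[ q ] upper x q × lower y q

_≤ᶜ_ : Cut → Cut → Set
x ≤ᶜ y = ¬ (y <ᶜ x)

_+ᶜ_ : Cut → Cut → Cut
(x +ᶜ y) .lower q = ∃[ a ] ∃[ b ] lower x a × lower y b × q < a + b
(x +ᶜ y) .upper q = ∃[ a ] ∃[ b ] upper x a × upper y b × a + b < q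

-- Interval multiplication, valid for factors of either sign: for
-- a < x < b and c < y < d the product xy lies between the least and the
-- greatest of ac, ad, bc, bd.
_*ᶜ_ : Cut → Cut → Cut
(x *ᶜ y) .lower q =
  ∃[ a ] ∃[ b ] ∃[ c ] ∃[ d ] lower x a × upper x b × lower y c × upper y d ×
    q < (a * c ⊓ a * d) ⊓ (b * c ⊓ b * d)
(x *ᶜ y) .upper q =
  ∃[ a ] ∃[ b ] ∃[ c ] ∃[ d ] lower x a × upper x b × lower y c × upper y d ×
    (a * c ⊔ a * d) ⊔ (b * c ⊔ b * d) < q

posPart negPart : ℤ → ℕ
posPart (+ m)    = m
posPart -[1+ m ] = 0
negPart (+ m)    = 0
negPart -[1+ m ] = suc m

-- m ^ s < t and t < m ^ s, for m ≥ 1 and a rational exponent s = u / v: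
-- for t > 0, both sides are raised to the power v and then multiplied by
-- m ^ (- u) if u < 0.
PowerBelow : ℕ → ℚ → ℚ → Set
PowerBelow m s t =
  0ℚ < t × (+ m / 1) ^ posPart (↥ s) < t ^ (↧ₙ s) * (+ m / 1) ^ negPart (↥ s)

PowerAbove : ℕ → ℚ → ℚ → Set
PowerAbove m s t =
  t ≤ 0ℚ ⊎ t ^ (↧ₙ s) * (+ m / 1) ^ negPart (↥ s) < (+ m / 1) ^ posPart (↥ s)

-- The real power m ^ x, for m ≥ 1, as the common limit of the powers
-- m ^ s over rationals s < x and over rationals s > x.
_^ᶜ_ : ℕ → Cut → Cut
(m ^ᶜ x) .lower t = ∃[ s ] lower x s × PowerAbove m s t
(m ^ᶜ x) .upper t = ∃[ s ] upper x s × PowerBelow m s t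

-- Meaningful for m ≥ 1; the cut at m = 0 is not a real number.
log₂ : ℕ → Cut
log₂ m .lower s = PowerBelow 2 s (+ m / 1)
log₂ m .upper s = PowerAbove 2 s (+ m / 1)

infix 4 _⟶_

_⟶_ : (ℕ → Cut) → ℚ → Set
x ⟶ ℓ = ∀ δ → 0ℚ < δ →
  ∃[ N ] ∀ n → N ℕ.≤ n → lower (x n) (ℓ - δ) × upper (x n) (ℓ + δ)

------------------------------------------------------------------------
-- The random graph G(n,p)

sumℚ : List ℚ → ℚ
sumℚ = List.foldr _+_ 0ℚ

graphs : ∀ n → List (Graph n)
graphs zero    = [] ∷ []
graphs (suc n) = cartesianProductWith _∷_ (bitVecs n) (graphs n)

edgeWeight : ℚ → Bool → ℚ
edgeWeight p b = if b then p else 1ℚ - p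

-- The probability of a single graph: by independence, the product over
-- all pairs of vertices of p (edge present) or 1 - p (edge absent).
weight : ∀ {n} → ℚ → Graph n → ℚ
weight p []      = 1ℚ
weight p (r ∷ g) = Vec.foldr (λ _ → ℚ) (λ b w → edgeWeight p b * w) 1ℚ r * weight p g

mass : ∀ {n} → ℚ → (Graph n → Bool) → ℚ
mass {n} p B = sumℚ (List.map (λ g → if B g then weight p g else 0ℚ) (graphs n))

-- The probability of an arbitrary event A.  An inequality between reals
-- need not be decidable, so the mass of A is taken as the cut given by
-- the masses of decidable events inside A (from below) and around A (from
-- above).  If A is itself decidable, this is the cut of its mass.
Pr : ∀ n → ℚ → (Graph n → Set) → Cut
Pr n p A .lower q = ∃[ B ] (∀ g → B g ≡ true → A g) × q < mass p B
Pr n p A .upper q = ∃[ B ] (∀ g → A g → B g ≡ true) × mass p B < q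

{-# OPTIONS --safe #-}

-- The expected number of cliques of G(n,1/2) is Σ C(n,t) 2^(-t(t-1)/2), at most
-- K = (n+1) 2^(m(m+1)/2) for n ≤ 2^m, and the same bound holds for independent sets.  By
-- Markov's inequality i(G) + k(G) ≤ n K with probability at least 1 - 2/n, and then
-- π(G) ≤ (n K)².  With l = ⌊log₂ n⌋ and m = l + 1 this is at most n^(l+11), as 2^l ≤ n, and
-- ε(n) = 22/(l+1) gives (1+ε(n)) log₂ n ≥ (1+ε(n)) l ≥ l + 11.
module Submission where

open import Defs
open import Algebra.Bundles using (CommutativeMonoid)
import Algebra.Definitions.RawSemiring as RawSemiring
open import Data.Bool.Base using (Bool; true; false; not; _∧_; if_then_else_)
import Data.Bool.Properties as Bool
open import Data.Fin.Base using (zero; suc)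
import Data.Fin.Properties as Fin
open import Data.Fin.Subset using (Subset)
import Data.Integer.Properties as ℤ
open import Data.List.Base using (List; []; _∷_; _++_; map; length; filter; cartesianProductWith)
open import Data.List.Properties using (map-++; map-∘)
open import Data.Nat.Base
open import Data.Nat.Coprimality using (Coprime; 1-coprimeTo) renaming (sym to coprime-sym)
open import Data.Nat.Induction using (<-rec)
open import Data.Nat.ListAction using (sum)
open import Data.Nat.ListAction.Properties using (sum-++)
open import Data.Nat.Logarithm
open import Data.Nat.Properties
open import Data.Nat.Tactic.RingSolver using (solve-∀)
open import Data.Product.Base using (Σ; ∃-syntax; _×_; _,_)
open import Data.Rational.Base as ℚ using (ℚ; mkℚ; 0ℚ; 1ℚ; ½; *<*; *≤*)
import Data.Rational.Properties as ℚ
open import Data.Rational.Solver using (module +-*-Solver)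
open import Data.Rational.Unnormalised.Base as ℚᵘ using (mkℚᵘ; *≡*)
import Data.Rational.Unnormalised.Properties as ℚᵘ
open import Data.Sum.Base using (inj₁; inj₂)
open import Data.Vec.Base as Vec using (Vec; []; _∷_; here; there)
open import Function.Base using (_∘_)
open import Function.Bundles using (mk⇔; Equivalence)
open import Level using (0ℓ)
open import Relation.Binary.PropositionalEquality
open import Relation.Nullary using (¬_; Dec; does; yes; no; contradiction)
open import Relation.Nullary.Decidable using (dec-true)
open import Relation.Unary using (Pred; Decidable)

open import Algebra.Properties.CommutativeSemigroup
  (CommutativeMonoid.commutativeSemigroup ℚ.*-1-commutativeMonoid) using (interchange)
open RawSemiring ℚ.+-*-rawSemiring using () renaming (_^_ to _^ℚ_)

private
  variable
    A B C : Set
    n : ℕ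

-- Finite sums

∑ : List A → (A → ℕ) → ℕ
∑ xs f = sum (map f xs)

𝟙 : Bool → ℕ
𝟙 b = if b then 1 else 0

𝟙-∧ : ∀ a b → 𝟙 (a ∧ b) ≡ 𝟙 a * 𝟙 b
𝟙-∧ true  b = sym (+-identityʳ (𝟙 b))
𝟙-∧ false b = refl

∑-cong : ∀ {f g : A → ℕ} xs → (∀ x → f x ≡ g x) → ∑ xs f ≡ ∑ xs g
∑-cong []       f≡g = refl
∑-cong (x ∷ xs) f≡g = cong₂ _+_ (f≡g x) (∑-cong xs f≡g)

∑-mono : ∀ {f g : A → ℕ} xs → (∀ x → f x ≤ g x) → ∑ xs f ≤ ∑ xs g
∑-mono []       f≤g = z≤n
∑-mono (x ∷ xs) f≤g = +-mono-≤ (f≤g x) (∑-mono xs f≤g)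

∑-++ : ∀ xs ys (f : A → ℕ) → ∑ (xs ++ ys) f ≡ ∑ xs f + ∑ ys f
∑-++ xs ys f = trans (cong sum (map-++ f xs ys)) (sum-++ (map f xs) (map f ys))

∑-+ : ∀ xs (f g : A → ℕ) → ∑ xs (λ x → f x + g x) ≡ ∑ xs f + ∑ xs g
∑-+ []       f g = refl
∑-+ (x ∷ xs) f g =
  trans (cong (f x + g x +_) (∑-+ xs f g)) (swap (f x) (g x) (∑ xs f) (∑ xs g))
  where
  swap : ∀ a b c d → (a + b) + (c + d) ≡ (a + c) + (b + d)
  swap = solve-∀

∑-*ˡ : ∀ c xs (f : A → ℕ) → ∑ xs (λ x → c * f x) ≡ c * ∑ xs f
∑-*ˡ c []       f = sym (*-zeroʳ c)
∑-*ˡ c (x ∷ xs) f =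
  trans (cong (c * f x +_) (∑-*ˡ c xs f)) (sym (*-distribˡ-+ c (f x) (∑ xs f)))

∑-*ʳ : ∀ c xs (f : A → ℕ) → ∑ xs (λ x → f x * c) ≡ ∑ xs f * c
∑-*ʳ c xs f = trans (∑-cong xs (λ x → *-comm (f x) c))
                    (trans (∑-*ˡ c xs f) (*-comm c (∑ xs f)))

∑-zero : ∀ (xs : List A) → ∑ xs (λ _ → 0) ≡ 0
∑-zero []       = refl
∑-zero (x ∷ xs) = ∑-zero xs

∑-comm : ∀ (xs : List A) (ys : List B) (f : A → B → ℕ) →
         ∑ xs (λ x → ∑ ys (f x)) ≡ ∑ ys (λ y → ∑ xs (λ x → f x y))
∑-comm []       ys f = sym (∑-zero ys)
∑-comm (x ∷ xs) ys f =
  trans (cong (∑ ys (f x) +_) (∑-comm xs ys f))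
        (sym (∑-+ ys (f x) (λ y → ∑ xs (λ x → f x y))))

∑-cartesianProductWith : ∀ (h : A → B → C) xs ys (f : C → ℕ) →
  ∑ (cartesianProductWith h xs ys) f ≡ ∑ xs (λ x → ∑ ys (λ y → f (h x y)))
∑-cartesianProductWith h []       ys f = refl
∑-cartesianProductWith h (x ∷ xs) ys f = trans (∑-++ (map (h x) ys) _ f)
  (cong₂ _+_ (cong sum (sym (map-∘ ys))) (∑-cartesianProductWith h xs ys f))

∑-bitVecs : ∀ n (f : Vec Bool (suc n) → ℕ) →
  ∑ (bitVecs (suc n)) f ≡ ∑ (bitVecs n) (f ∘ (true ∷_)) + ∑ (bitVecs n) (f ∘ (false ∷_))
∑-bitVecs n f = trans (∑-cartesianProductWith _∷_ (true ∷ false ∷ []) (bitVecs n) f)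
  (cong (∑ (bitVecs n) (f ∘ (true ∷_)) +_) (+-identityʳ _))

-- Replaces the decision procedures counted by `k` and `i` with a Boolean test that follows the
-- recursion of `Graph`; an upper bound asks only that the test accept whatever satisfies `P`.
length-filter≤∑ : ∀ {P : Pred A 0ℓ} (P? : Decidable P) (b : A → Bool) →
  (∀ x → P x → b x ≡ true) → ∀ xs → length (filter P? xs) ≤ ∑ xs (𝟙 ∘ b)
length-filter≤∑ P? b P⇒b [] = z≤n
length-filter≤∑ P? b P⇒b (x ∷ xs) with P? x
... | yes p rewrite P⇒b x p = s≤s (length-filter≤∑ P? b P⇒b xs)
... | no  _ = ≤-trans (length-filter≤∑ P? b P⇒b xs) (m≤n+m _ (𝟙 (b x)))

∑-complement : ∀ (b : A → Bool) xs → ∑ xs (𝟙 ∘ b) + ∑ xs (𝟙 ∘ not ∘ b) ≡ ∑ xs (λ _ → 1)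
∑-complement b xs = trans (sym (∑-+ xs _ _)) (∑-cong xs (λ x → split (b x)))
  where
  split : ∀ c → 𝟙 c + 𝟙 (not c) ≡ 1
  split true  = refl
  split false = refl

-- Pointwise, `t` times the indicator of `X x > t` is at most `X x`. The division-free form keeps
-- the counting in ℕ.
markov : ∀ (X : A → ℕ) t xs → t * ∑ xs (λ x → 𝟙 (not (does (X x ≤? t)))) ≤ ∑ xs X
markov X t xs = ≤-trans (≤-reflexive (sym (∑-*ˡ t xs _))) (∑-mono xs (λ x → pointwise (X x ≤? t)))
  where
  pointwise : ∀ {a} (a≤?t : Dec (a ≤ t)) → t * 𝟙 (not (does a≤?t)) ≤ a
  pointwise (yes _)  = ≤-trans (≤-reflexive (*-zeroʳ t)) z≤n
  pointwise (no a≰t) = ≤-trans (≤-reflexive (*-identityʳ t)) (<⇒≤ (≰⇒> a≰t))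

-- Counting homogeneous sets

-- The binomial coefficient n(n-1)/2; the recursion mirrors `Graph`, whose new vertex brings a row
-- of length `n`.
pairs : ℕ → ℕ
pairs zero    = 0
pairs (suc n) = n + pairs n

∣bitVecs∣ : ∀ n → ∑ (bitVecs n) (λ _ → 1) ≡ 2 ^ n
∣bitVecs∣ zero    = refl
∣bitVecs∣ (suc n) = trans (∑-bitVecs n _)
  (trans (cong₂ _+_ (∣bitVecs∣ n) (∣bitVecs∣ n)) (cong (2 ^ n +_) (sym (+-identityʳ _))))

∣graphs∣ : ∀ n → ∑ (graphs n) (λ _ → 1) ≡ 2 ^ pairs n
∣graphs∣ zero    = refl
∣graphs∣ (suc n) = begin
  ∑ (graphs (suc n)) (λ _ → 1)
    ≡⟨ ∑-cartesianProductWith _∷_ (bitVecs n) (graphs n) _ ⟩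
  ∑ (bitVecs n) (λ _ → ∑ (graphs n) (λ _ → 1))
    ≡⟨ ∑-cong (bitVecs n) (λ _ → trans (∣graphs∣ n) (sym (+-identityʳ _))) ⟩
  ∑ (bitVecs n) (λ _ → 1 * 2 ^ pairs n)
    ≡⟨ ∑-*ʳ (2 ^ pairs n) (bitVecs n) (λ _ → 1) ⟩
  ∑ (bitVecs n) (λ _ → 1) * 2 ^ pairs n
    ≡⟨ cong (_* 2 ^ pairs n) (∣bitVecs∣ n) ⟩
  2 ^ n * 2 ^ pairs n
    ≡⟨ ^-distribˡ-+-* 2 n (pairs n) ⟨
  2 ^ (n + pairs n) ∎
  where open ≡-Reasoning

uniformOn : Bool → Vec Bool n → Subset n → Bool
uniformOn b []      []          = true
uniformOn b (x ∷ r) (true  ∷ s) = does (x Bool.≟ b) ∧ uniformOn b r s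
uniformOn b (x ∷ r) (false ∷ s) = uniformOn b r s

-- Cliques for `b = true`, independent sets for `b = false`. Peeling off vertex 0 lets sums over
-- graphs be computed one row at a time.
homogeneous : Bool → Graph n → Subset n → Bool
homogeneous b []      []          = true
homogeneous b (r ∷ g) (true  ∷ s) = uniformOn b r s ∧ homogeneous b g s
homogeneous b (r ∷ g) (false ∷ s) = homogeneous b g s

uniformOn-complete : ∀ b (r : Vec Bool n) s →
  (∀ j → s Vec.[ j ]= true → Vec.lookup r j ≡ b) → uniformOn b r s ≡ true
uniformOn-complete b []      []          h = refl
uniformOn-complete b (x ∷ r) (true  ∷ s) h =
  cong₂ _∧_ (dec-true (x Bool.≟ b) (h zero here))
            (uniformOn-complete b r s (λ j p → h (suc j) (there p)))
uniformOn-complete b (x ∷ r) (false ∷ s) h =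
  uniformOn-complete b r s (λ j p → h (suc j) (there p))

-- The hypothesis is `IsClique g s` or `IsIndependent g s` according to `b`, so sums of
-- `homogeneous` bound `k g` and `i g` from above.
homogeneous-complete : ∀ b (g : Graph n) s →
  (∀ i → s Vec.[ i ]= true → ∀ j → s Vec.[ j ]= true → i ≢ j → adj g i j ≡ b) →
  homogeneous b g s ≡ true
homogeneous-complete b []      []          h = refl
homogeneous-complete b (r ∷ g) (true  ∷ s) h = cong₂ _∧_
  (uniformOn-complete b r s (λ j p → h zero here (suc j) (there p) Fin.0≢1+n))
  (homogeneous-complete b g s
    (λ i p j q i≢j → h (suc i) (there p) (suc j) (there q) (i≢j ∘ Fin.suc-injective)))
homogeneous-complete b (r ∷ g) (false ∷ s) h = homogeneous-complete b g s
    (λ i p j q i≢j → h (suc i) (there p) (suc j) (there q) (i≢j ∘ Fin.suc-injective))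

-- Counting the vertices outside `s`, rather than inside, keeps all powers of 2 below in ℕ.
codim : Subset n → ℕ
codim []          = 0
codim (true  ∷ s) = codim s
codim (false ∷ s) = suc (codim s)

-- The bits at positions in `s` are forced to be `b`; the others are free.
∑-uniformOn : ∀ b (s : Subset n) → ∑ (bitVecs n) (λ r → 𝟙 (uniformOn b r s)) ≡ 2 ^ codim s
∑-uniformOn b [] = refl
∑-uniformOn {suc n} b (true ∷ s) = trans (∑-bitVecs n _) (one b)
  where
  -- Of the two values of the first bit only `b` survives; the other half of the sum is zero.
  one : ∀ b → ∑ (bitVecs n) (λ r → 𝟙 (does (true  Bool.≟ b) ∧ uniformOn b r s)) +
              ∑ (bitVecs n) (λ r → 𝟙 (does (false Bool.≟ b) ∧ uniformOn b r s)) ≡ 2 ^ codim s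
  one true  = trans (cong₂ _+_ (∑-uniformOn true s) (∑-zero (bitVecs n))) (+-identityʳ _)
  one false = cong₂ _+_ (∑-zero (bitVecs n)) (∑-uniformOn false s)
∑-uniformOn {suc n} b (false ∷ s) = trans (∑-bitVecs n _)
  (trans (cong₂ _+_ (∑-uniformOn b s) (∑-uniformOn b s)) (cong (2 ^ codim s +_) (sym (+-identityʳ _))))

-- Generating function of homogeneous sets by codimension

^-distribʳ-* : ∀ a b c → (a * b) ^ c ≡ a ^ c * b ^ c
^-distribʳ-* a b zero    = refl
^-distribʳ-* a b (suc c) = trans (cong (a * b *_) (^-distribʳ-* a b c)) (ring a b (a ^ c) (b ^ c))
  where
  ring : ∀ a b x y → a * b * (x * y) ≡ a * x * (b * y)
  ring = solve-∀

-- The count of homogeneous sets is the value at `x = 1`. Adding a vertex weights each set by a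
-- power of 2 to its codimension, that is, doubles `x`, so the induction runs over all points
-- `2 ^ j`.
homogeneousGF : Bool → Graph n → ℕ → ℕ
homogeneousGF {n} b g x = ∑ (bitVecs n) (λ s → 𝟙 (homogeneous b g s) * x ^ codim s)

totalGF : Bool → ∀ n → ℕ → ℕ
totalGF b n x = ∑ (graphs n) (λ g → homogeneousGF b g x)

-- Averaging over the row of vertex 0: a homogeneous set s of the remaining graph extends
-- by vertex 0 for 2 ^ codim s of the 2 ^ n rows.
totalGF-suc : ∀ b n x → totalGF b (suc n) x ≡ totalGF b n (2 * x) + 2 ^ n * (x * totalGF b n x)
totalGF-suc b n x = begin
  totalGF b (suc n) x
    ≡⟨ ∑-cartesianProductWith _∷_ (bitVecs n) (graphs n) _ ⟩
  ∑ R (λ r → ∑ G (λ g → homogeneousGF b (r ∷ g) x))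
    ≡⟨ ∑-cong R (λ r → ∑-cong G (λ g → ∑-bitVecs n _)) ⟩
  ∑ R (λ r → ∑ G (λ g → with0 r g + without0 g))
    ≡⟨ ∑-cong R (λ r → ∑-+ G _ _) ⟩
  ∑ R (λ r → ∑ G (with0 r) + ∑ G without0)
    ≡⟨ ∑-+ R _ _ ⟩
  ∑ R (λ r → ∑ G (with0 r)) + ∑ R (λ _ → ∑ G without0)
    ≡⟨ cong₂ _+_ (trans (∑-comm R G with0) (∑-cong G ∑-with0)) ∑-without0 ⟩
  totalGF b n (2 * x) + 2 ^ n * (x * totalGF b n x) ∎
  where
  open ≡-Reasoning
  R = bitVecs n
  G = graphs n
  with0 : Vec Bool n → Graph n → ℕ
  with0 r g = ∑ R (λ s → 𝟙 (uniformOn b r s ∧ homogeneous b g s) * x ^ codim s)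
  without0 : Graph n → ℕ
  -- Leaving vertex 0 out raises the codimension by one, hence the extra factor `x`.
  without0 g = ∑ R (λ s → 𝟙 (homogeneous b g s) * (x * x ^ codim s))

  ∑-with0 : ∀ g → ∑ R (λ r → with0 r g) ≡ homogeneousGF b g (2 * x)
  ∑-with0 g = trans (∑-comm R R _) (∑-cong R λ s → begin
    ∑ R (λ r → 𝟙 (uniformOn b r s ∧ homogeneous b g s) * x ^ codim s)
      ≡⟨ ∑-cong R (λ r → trans (cong (_* x ^ codim s) (𝟙-∧ (uniformOn b r s) _))
                               (*-assoc (𝟙 (uniformOn b r s)) _ _)) ⟩
    ∑ R (λ r → 𝟙 (uniformOn b r s) * (𝟙 (homogeneous b g s) * x ^ codim s))
      ≡⟨ ∑-*ʳ _ R _ ⟩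
    ∑ R (λ r → 𝟙 (uniformOn b r s)) * (𝟙 (homogeneous b g s) * x ^ codim s)
      ≡⟨ cong (_* (𝟙 (homogeneous b g s) * x ^ codim s)) (∑-uniformOn b s) ⟩
    2 ^ codim s * (𝟙 (homogeneous b g s) * x ^ codim s)
      ≡⟨ ring (2 ^ codim s) (𝟙 (homogeneous b g s)) (x ^ codim s) ⟩
    𝟙 (homogeneous b g s) * (2 ^ codim s * x ^ codim s)
      ≡⟨ cong (𝟙 (homogeneous b g s) *_) (^-distribʳ-* 2 x (codim s)) ⟨
    𝟙 (homogeneous b g s) * (2 * x) ^ codim s ∎)
    where
    ring : ∀ a b c → a * (b * c) ≡ b * (a * c)
    ring = solve-∀

  ∑-without0 : ∑ R (λ _ → ∑ G without0) ≡ 2 ^ n * (x * totalGF b n x)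
  ∑-without0 = begin
    ∑ R (λ _ → ∑ G without0)       ≡⟨ ∑-cong R (λ _ → sym (+-identityʳ _)) ⟩
    ∑ R (λ _ → 1 * ∑ G without0)   ≡⟨ ∑-*ʳ _ R (λ _ → 1) ⟩
    ∑ R (λ _ → 1) * ∑ G without0   ≡⟨ cong₂ _*_ (∣bitVecs∣ n) (trans (∑-cong G λ g →
                                        trans (∑-cong R (λ s → ring (𝟙 (homogeneous b g s)) x _)) (∑-*ˡ x R _))
                                        (∑-*ˡ x G _)) ⟩
    2 ^ n * (x * totalGF b n x)    ∎
    where
    ring : ∀ a b c → a * (b * c) ≡ b * (a * c)
    ring = solve-∀

triangle : ℕ → ℕ
triangle zero    = 0
triangle (suc d) = suc d + triangle d

-- For `j < m` the two sides agree, since the triangles differ by `m ∸ j`. For `j ≥ m` truncated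
-- subtraction makes both triangles zero and `m ≤ j` remains.
triangle-∸ : ∀ m j → m + triangle (m ∸ suc j) ≤ j + triangle (m ∸ j)
triangle-∸ m j with ≤-total m j
... | inj₁ m≤j rewrite m≤n⇒m∸n≡0 m≤j | m≤n⇒m∸n≡0 (m≤n⇒m≤1+n m≤j) = +-monoˡ-≤ 0 m≤j
... | inj₂ j≤m with m≤n⇒∃[o]m+o≡n j≤m
... | zero  , refl rewrite +-identityʳ j | n∸n≡0 j | m≤n⇒m∸n≡0 (n≤1+n j) = ≤-refl
... | suc d , refl rewrite m+n∸m≡n j (suc d) | +-suc j d | m+n∸m≡n j d =
  ≤-reflexive (ring j d (triangle d))
  where
  ring : ∀ j d t → suc (j + d) + t ≡ j + (suc d + t)
  ring = solve-∀

-- The term with index t of E[k(G)] = Σ C(n,t) 2^(-t(t-1)/2) is at most 2^(mt - t(t-1)/2) when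
-- n ≤ 2 ^ m, which is largest at t = m; j is the number of vertices chosen so far.
totalGF-bound : ∀ b m n j → n ≤ 2 ^ m →
  totalGF b n (2 ^ j) ≤ suc n * 2 ^ triangle (m ∸ j) * (2 ^ pairs n * (2 ^ j) ^ n)
totalGF-bound b m zero    j n≤2^m = begin
  1                                      ≤⟨ m^n>0 2 (triangle (m ∸ j)) ⟩
  2 ^ triangle (m ∸ j)                   ≡⟨ ring (2 ^ triangle (m ∸ j)) ⟩
  1 * 2 ^ triangle (m ∸ j) * (1 * 1)     ∎
  where
  open ≤-Reasoning
  ring : ∀ a → a ≡ 1 * a * (1 * 1)
  ring = solve-∀
totalGF-bound b m (suc n) j n<2^m = begin
  totalGF b (suc n) x
    ≡⟨ totalGF-suc b n x ⟩
  totalGF b n (2 * x) + 2 ^ n * (x * totalGF b n x)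
    ≤⟨ +-mono-≤ (totalGF-bound b m n (suc j) n≤2^m)
                (*-monoʳ-≤ (2 ^ n) (*-monoʳ-≤ x (totalGF-bound b m n j n≤2^m))) ⟩
  suc n * f′ * (2 ^ pairs n * (2 * x) ^ n) + 2 ^ n * (x * (suc n * f * (2 ^ pairs n * x ^ n)))
    ≡⟨ cong (λ y → suc n * f′ * (2 ^ pairs n * y) + 2 ^ n * (x * (suc n * f * (2 ^ pairs n * x ^ n))))
            (^-distribʳ-* 2 x n) ⟩
  suc n * f′ * (2 ^ pairs n * (2 ^ n * x ^ n)) + 2 ^ n * (x * (suc n * f * (2 ^ pairs n * x ^ n)))
    ≤⟨ +-monoˡ-≤ _ (*-monoˡ-≤ (2 ^ pairs n * (2 ^ n * x ^ n)) next) ⟩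
  x * f * (2 ^ pairs n * (2 ^ n * x ^ n)) + 2 ^ n * (x * (suc n * f * (2 ^ pairs n * x ^ n)))
    ≡⟨ ring n x f (2 ^ pairs n) (2 ^ n) (x ^ n) ⟩
  suc (suc n) * f * (2 ^ n * 2 ^ pairs n * (x * x ^ n))
    ≡⟨ cong (λ y → suc (suc n) * f * (y * (x * x ^ n))) (^-distribˡ-+-* 2 n (pairs n)) ⟨
  suc (suc n) * f * (2 ^ pairs (suc n) * x ^ suc n) ∎
  where
  open ≤-Reasoning
  x  = 2 ^ j
  f  = 2 ^ triangle (m ∸ j)
  f′ = 2 ^ triangle (m ∸ suc j)
  n≤2^m : n ≤ 2 ^ m
  n≤2^m = ≤-trans (n≤1+n n) n<2^m
  -- The branch containing vertex 0 thus costs one share `x * f`; with the `suc n` shares of the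
  -- other branch this gives the factor `suc (suc n)`.
  next : suc n * f′ ≤ x * f
  next = begin
    suc n * f′                          ≤⟨ *-monoˡ-≤ f′ n<2^m ⟩
    2 ^ m * f′                          ≡⟨ ^-distribˡ-+-* 2 m _ ⟨
    2 ^ (m + triangle (m ∸ suc j))      ≤⟨ ^-monoʳ-≤ 2 (triangle-∸ m j) ⟩
    2 ^ (j + triangle (m ∸ j))          ≡⟨ ^-distribˡ-+-* 2 j _ ⟩
    x * f                               ∎
  ring : ∀ n x f p q y → x * f * (p * (q * y)) + q * (x * ((1 + n) * f * (p * y))) ≡
                         (2 + n) * f * (q * p * (x * y))
  ring = solve-∀

-- First moment and Markov bound

meanBound : ℕ → ℕ → ℕ
meanBound m n = suc n * 2 ^ triangle m

∑-homogeneous : ∀ b m n → n ≤ 2 ^ m →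
  ∑ (graphs n) (λ g → ∑ (bitVecs n) (λ s → 𝟙 (homogeneous b g s))) ≤ meanBound m n * 2 ^ pairs n
∑-homogeneous b m n n≤2^m = begin
  ∑ (graphs n) (λ g → ∑ (bitVecs n) (λ s → 𝟙 (homogeneous b g s)))
    ≡⟨ ∑-cong (graphs n) (λ g → ∑-cong (bitVecs n) (λ s →
         trans (cong (𝟙 (homogeneous b g s) *_) (^-zeroˡ (codim s))) (*-identityʳ _))) ⟨
  totalGF b n (2 ^ 0)
    ≤⟨ totalGF-bound b m n 0 n≤2^m ⟩
  meanBound m n * (2 ^ pairs n * 1 ^ n)
    ≡⟨ cong (meanBound m n *_) (trans (cong (2 ^ pairs n *_) (^-zeroˡ n)) (*-identityʳ _)) ⟩
  meanBound m n * 2 ^ pairs n ∎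
  where open ≤-Reasoning

-- Taking the sum `i g + k g` as one variable lets a single use of Markov's inequality control both
-- factors of `π g`.
∑-i+k : ∀ m n → n ≤ 2 ^ m →
  ∑ (graphs n) (λ g → i g + k g) ≤ meanBound m n * (2 * 2 ^ pairs n)
∑-i+k m n n≤2^m = begin
  ∑ (graphs n) (λ g → i g + k g)
    ≤⟨ ∑-mono (graphs n) (λ g → +-mono-≤
         (length-filter≤∑ (isIndependent? g) _ (homogeneous-complete false g) (bitVecs n))
         (length-filter≤∑ (isClique? g) _ (homogeneous-complete true g) (bitVecs n))) ⟩
  ∑ (graphs n) (λ g → H false g + H true g)
    ≡⟨ ∑-+ (graphs n) _ _ ⟩
  ∑ (graphs n) (H false) + ∑ (graphs n) (H true)
    ≤⟨ +-mono-≤ (∑-homogeneous false m n n≤2^m) (∑-homogeneous true m n n≤2^m) ⟩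
  meanBound m n * 2 ^ pairs n + meanBound m n * 2 ^ pairs n
    ≡⟨ ring (meanBound m n) (2 ^ pairs n) ⟩
  meanBound m n * (2 * 2 ^ pairs n) ∎
  where
  open ≤-Reasoning
  H : Bool → Graph n → ℕ
  H b g = ∑ (bitVecs n) (λ s → 𝟙 (homogeneous b g s))
  ring : ∀ a b → a * b + a * b ≡ a * (2 * b)
  ring = solve-∀

-- The extra factor `n` over the mean bound makes the exceptional graphs a fraction of at most 2/n,
-- and costs only a factor n² in the bound for `π`.
small : ∀ n → ℕ → Graph n → Bool
small n m g = does (i g + k g ≤? n * meanBound m n)

-- Markov's inequality at threshold `n * K` leaves a common positive factor `K`, which cancels.
large-rare : ∀ m n → n ≤ 2 ^ m →
  n * ∑ (graphs n) (λ g → 𝟙 (not (small n m g))) ≤ 2 * 2 ^ pairs n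
large-rare m n n≤2^m = *-cancelˡ-≤ (meanBound m n) (begin
  K * (n * L)                        ≡⟨ ring K n L ⟩
  n * K * L                          ≤⟨ markov (λ g → i g + k g) (n * K) (graphs n) ⟩
  ∑ (graphs n) (λ g → i g + k g)     ≤⟨ ∑-i+k m n n≤2^m ⟩
  K * (2 * 2 ^ pairs n)              ∎)
  where
  open ≤-Reasoning
  K = meanBound m n
  L = ∑ (graphs n) (λ g → 𝟙 (not (small n m g)))
  instance
    K≢0 : NonZero (meanBound m n)
    K≢0 = m*n≢0 (suc n) (2 ^ triangle m) {{_}} {{m^n≢0 2 (triangle m)}}
  ring : ∀ a b c → a * (b * c) ≡ b * a * c
  ring = solve-∀

-- Binary logarithms

double-triangle : ∀ m → triangle m + triangle m ≡ m * suc m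
double-triangle zero    = refl
double-triangle (suc m) = trans (ring₁ m (triangle m))
  (trans (cong (2 * suc m +_) (double-triangle m)) (ring₂ m))
  where
  ring₁ : ∀ m t → (suc m + t) + (suc m + t) ≡ 2 * suc m + (t + t)
  ring₁ = solve-∀
  ring₂ : ∀ m → 2 * suc m + m * suc m ≡ suc m * suc (suc m)
  ring₂ = solve-∀

-- Strong induction along halving, which lowers the logarithm by one.
2^⌊log₂n⌋≤n : ∀ n .{{_ : NonZero n}} → 2 ^ ⌊log₂ n ⌋ ≤ n
2^⌊log₂n⌋≤n n = <-rec (λ n → .{{NonZero n}} → 2 ^ ⌊log₂ n ⌋ ≤ n) step n
  where
  open ≤-Reasoning
  double-half : ∀ n → 2 * ⌊ n /2⌋ ≤ n
  double-half n = begin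
    2 * ⌊ n /2⌋            ≡⟨ cong (⌊ n /2⌋ +_) (+-identityʳ _) ⟩
    ⌊ n /2⌋ + ⌊ n /2⌋      ≤⟨ +-monoʳ-≤ ⌊ n /2⌋ (⌊n/2⌋≤⌈n/2⌉ n) ⟩
    ⌊ n /2⌋ + ⌈ n /2⌉      ≡⟨ ⌊n/2⌋+⌈n/2⌉≡n n ⟩
    n                      ∎
  step : ∀ n → (∀ {h} → h < n → .{{NonZero h}} → 2 ^ ⌊log₂ h ⌋ ≤ h) → .{{NonZero n}} → 2 ^ ⌊log₂ n ⌋ ≤ n
  step (suc zero)          rec = ≤-reflexive (cong (2 ^_) (⌊log₂[2^n]⌋≡n 0))
  step n@(suc (suc n-2)) rec = begin
    -- With truncated subtraction, `l ≤ 1 + (l ∸ 1)` holds for every `l`, so no case `l = 0` has to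
    -- be excluded.
    2 ^ ⌊log₂ n ⌋                        ≤⟨ ^-monoʳ-≤ 2 (m≤n+m∸n ⌊log₂ n ⌋ 1) ⟩
    2 * 2 ^ (⌊log₂ n ⌋ ∸ 1)              ≡⟨ cong (λ l → 2 * 2 ^ l) (⌊log₂⌊n/2⌋⌋≡⌊log₂n⌋∸1 n) ⟨
    2 * 2 ^ ⌊log₂ ⌊ n /2⌋ ⌋              ≤⟨ *-monoʳ-≤ 2 (rec (⌊n/2⌋<n (suc n-2))) ⟩
    2 * ⌊ n /2⌋                          ≤⟨ double-half n ⟩
    n                                    ∎

-- Otherwise monotonicity of the logarithm would give `suc l ≤ l`.
n<2^[1+⌊log₂n⌋] : ∀ n → n < 2 ^ suc ⌊log₂ n ⌋
n<2^[1+⌊log₂n⌋] n = ≰⇒> λ 2^l≤n → 1+n≰n (begin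
  suc ⌊log₂ n ⌋                   ≡⟨ ⌊log₂[2^n]⌋≡n (suc ⌊log₂ n ⌋) ⟨
  ⌊log₂ 2 ^ suc ⌊log₂ n ⌋ ⌋       ≤⟨ ⌊log₂⌋-mono-≤ 2^l≤n ⟩
  ⌊log₂ n ⌋                       ∎)
  where open ≤-Reasoning

-- The 11 is 2 + 4 + 3 + 2: n² from the threshold, n⁴ from `suc n ≤ n * n` squared, and n³ and n²
-- from the factors 2^(3l) and 2² of 2^((l+1)(l+2)) = 2^(l² + 3l + 2). The factor 2^(l²) gives
-- `n ^ l`.
meanBound-square : ∀ n → 2 ≤ n →
  let c = n * meanBound (suc ⌊log₂ n ⌋) n in c * c ≤ n ^ (⌊log₂ n ⌋ + 11)
meanBound-square n 2≤n = begin
  (n * (suc n * t)) * (n * (suc n * t))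
    ≡⟨ ring n (suc n) t ⟩
  n * n * (suc n * suc n) * (t * t)
    ≤⟨ *-monoˡ-≤ (t * t) (*-monoʳ-≤ (n * n) (*-mono-≤ 1+n≤n*n 1+n≤n*n)) ⟩
  n * n * (n * n * (n * n)) * (t * t)
    ≡⟨ cong (n * n * (n * n * (n * n)) *_) t² ⟩
  n * n * (n * n * (n * n)) * ((2 ^ l) ^ l * (2 ^ l) ^ 3 * 2 ^ 2)
    ≤⟨ *-monoʳ-≤ (n * n * (n * n * (n * n)))
         (*-mono-≤ (*-mono-≤ (^-monoˡ-≤ l 2^l≤n) (^-monoˡ-≤ 3 2^l≤n)) (^-monoˡ-≤ 2 2≤n)) ⟩
  n * n * (n * n * (n * n)) * (n ^ l * n ^ 3 * n ^ 2)
    ≡⟨ ring′ n (n ^ l) ⟩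
  n ^ l * n ^ 11
    ≡⟨ ^-distribˡ-+-* n l 11 ⟨
  n ^ (l + 11) ∎
  where
  open ≤-Reasoning
  l = ⌊log₂ n ⌋
  t = 2 ^ triangle (suc l)
  2^l≤n : 2 ^ l ≤ n
  2^l≤n = 2^⌊log₂n⌋≤n n {{>-nonZero (≤-trans (s≤s z≤n) 2≤n)}}
  1+n≤n*n : suc n ≤ n * n
  1+n≤n*n = begin
    1 + n       ≤⟨ +-monoˡ-≤ n (≤-trans (s≤s z≤n) 2≤n) ⟩
    n + n       ≡⟨ cong (n +_) (+-identityʳ n) ⟨
    2 * n       ≤⟨ *-monoˡ-≤ n 2≤n ⟩
    n * n       ∎
  t² : t * t ≡ (2 ^ l) ^ l * (2 ^ l) ^ 3 * 2 ^ 2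
  t² = begin-equality
    t * t                                     ≡⟨ ^-distribˡ-+-* 2 (triangle (suc l)) _ ⟨
    2 ^ (triangle (suc l) + triangle (suc l)) ≡⟨ cong (2 ^_) (double-triangle (suc l)) ⟩
    2 ^ (suc l * suc (suc l))                 ≡⟨ cong (2 ^_) (expand l) ⟩
    2 ^ (l * l + l * 3 + 2)                   ≡⟨ ^-distribˡ-+-* 2 (l * l + l * 3) 2 ⟩
    2 ^ (l * l + l * 3) * 2 ^ 2               ≡⟨ cong (_* 2 ^ 2) (^-distribˡ-+-* 2 (l * l) _) ⟩
    2 ^ (l * l) * 2 ^ (l * 3) * 2 ^ 2         ≡⟨ cong₂ (λ a b → a * b * 2 ^ 2) (^-*-assoc 2 l l) (^-*-assoc 2 l 3) ⟨
    (2 ^ l) ^ l * (2 ^ l) ^ 3 * 2 ^ 2         ∎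
    where
    expand : ∀ l → suc l * suc (suc l) ≡ l * l + l * 3 + 2
    expand = solve-∀
  ring : ∀ n s t → (n * (s * t)) * (n * (s * t)) ≡ n * n * (s * s) * (t * t)
  ring = solve-∀
  ring′ : ∀ n p → n * n * (n * n * (n * n)) * (p * (n * (n * (n * 1))) * (n * (n * 1))) ≡
    p * (n * (n * (n * (n * (n * (n * (n * (n * (n * (n * (n * 1)))))))))))
  ring′ = solve-∀

small⇒π≤ : ∀ n → 2 ≤ n → ∀ (g : Graph n) →
  i g + k g ≤ n * meanBound (suc ⌊log₂ n ⌋) n → π g ≤ n ^ (⌊log₂ n ⌋ + 11)
small⇒π≤ n 2≤n g i+k≤ = begin
  i g * k g                ≤⟨ *-mono-≤ (≤-trans (m≤m+n (i g) (k g)) i+k≤)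
                                       (≤-trans (m≤n+m (k g) (i g)) i+k≤) ⟩
  c * c                    ≤⟨ meanBound-square n 2≤n ⟩
  n ^ (⌊log₂ n ⌋ + 11)     ∎
  where
  open ≤-Reasoning
  c = n * meanBound (suc ⌊log₂ n ⌋) n

-- Rational powers and cuts

open import Data.Integer.Base as ℤ using (+_; -[1+_]; +<+; +≤+)

-- Written directly in lowest terms, so that numerator and denominator reduce for a variable `m`;
-- `/1≡ι` connects it with `+ m / 1`.
ι : ℕ → ℚ
ι m = mkℚ (+ m) 0 (coprime-sym (1-coprimeTo m))

/1≡ι : ∀ m → + m ℚ./ 1 ≡ ι m
/1≡ι m = ℚ.normalize-coprime (coprime-sym (1-coprimeTo m))

ι-+ : ∀ a b → ι (a + b) ≡ ι a ℚ.+ ι b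
ι-+ a b = trans (sym (/1≡ι (a + b)))
  (cong (ℚ._/ 1) (cong₂ ℤ._+_ (sym (ℤ.*-identityʳ (+ a))) (sym (ℤ.*-identityʳ (+ b)))))

ι-* : ∀ a b → ι (a * b) ≡ ι a ℚ.* ι b
ι-* a b = trans (sym (/1≡ι (a * b))) (cong (ℚ._/ 1) (ℤ.pos-* a b))

ι-^ : ∀ a e → ι (a ^ e) ≡ ι a ^ℚ e
ι-^ a zero    = refl
ι-^ a (suc e) = trans (ι-* a (a ^ e)) (cong (ι a ℚ.*_) (ι-^ a e))

ι-mono-≤ : ∀ {a b} → a ≤ b → ι a ℚ.≤ ι b
ι-mono-≤ {a} {b} a≤b =
  *≤* (ℤ.*-monoʳ-≤-nonNeg (+ 1) (+≤+ a≤b))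

ι-cancel-< : ∀ {a b} → ι a ℚ.< ι b → a < b
ι-cancel-< {a} {b} ιa<ιb = ≰⇒> λ b≤a → ℚ.<-irrefl refl (ℚ.<-≤-trans ιa<ιb (ι-mono-≤ b≤a))

ι-mono-< : ∀ {a b} → a < b → ι a ℚ.< ι b
ι-mono-< {a} {b} a<b =
  *<* (ℤ.*-monoʳ-<-pos (+ 1) (+<+ a<b))

^ℚ-nonNeg : ∀ x e → .{{ℚ.NonNegative x}} → ℚ.NonNegative (x ^ℚ e)
^ℚ-nonNeg x zero    = _
^ℚ-nonNeg x (suc e) = ℚ.nonNeg*nonNeg⇒nonNeg x (x ^ℚ e) {{^ℚ-nonNeg x e}}

^ℚ-monoˡ-≤ : ∀ {x y} e → .{{ℚ.NonNegative x}} → .{{ℚ.NonNegative y}} → x ℚ.≤ y → x ^ℚ e ℚ.≤ y ^ℚ e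
^ℚ-monoˡ-≤ zero    x≤y = ℚ.≤-refl
^ℚ-monoˡ-≤ {x} {y} (suc e) x≤y = ℚ.≤-trans
  (ℚ.*-monoʳ-≤-nonNeg (x ^ℚ e) {{^ℚ-nonNeg x e}} x≤y)
  (ℚ.*-monoˡ-≤-nonNeg y (^ℚ-monoˡ-≤ e x≤y))

ι<⇒ : ∀ m {u d} .{c : Coprime u (suc d)} → ι m ℚ.< mkℚ (+ u) d c → m * suc d < u
ι<⇒ m {u} {d} m<s =
  ℤ.drop‿+<+ (subst₂ ℤ._<_ (sym (ℤ.pos-* m (suc d))) (ℤ.*-identityʳ (+ u)) (ℚ.drop-*<* m<s))

ι<⇐ : ∀ m {u d} .{c : Coprime u (suc d)} → m * suc d < u → ι m ℚ.< mkℚ (+ u) d c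
ι<⇐ m {u} {d} md<u =
  *<* (subst₂ ℤ._<_ (ℤ.pos-* m (suc d)) (sym (ℤ.*-identityʳ (+ u))) (+<+ md<u))

ι≮neg : ∀ m {u d} .{c : Coprime (suc u) (suc d)} → ¬ (ι m ℚ.< mkℚ -[1+ u ] d c)
ι≮neg m {u} {d} {c} m<s = ℚ.<-asym (ℚ.negative⁻¹ (mkℚ -[1+ u ] d c)) (ℚ.≤-<-trans (ι-mono-≤ z≤n) m<s)

-- For `d` = u/v membership in the cut says n^v < 2^u, while u ≤ lv would give 2^u ≤ 2^(lv) ≤ n^v.
-- The cases `n ≤ 0` and `d < 0` contradict n ≥ 1.
upper-log₂⇒> : ∀ n l → 2 ^ l ≤ n → ∀ d → upper (log₂ n) d → ι l ℚ.< d
upper-log₂⇒> n l 2^l≤n d (inj₁ n≤0) =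
  contradiction (ℚ.<-≤-trans (ι-mono-< (≤-trans (m^n>0 2 l) 2^l≤n)) (subst (ℚ._≤ 0ℚ) (/1≡ι n) n≤0))
                (ℚ.<-irrefl refl)
upper-log₂⇒> n l 2^l≤n (mkℚ (+ u) d-1 _) (inj₂ n^v<2^u) rewrite /1≡ι n =
  ι<⇐ l (≰⇒> λ u≤lv → <⇒≱ n^v<2^u′ (begin
    2 ^ u              ≤⟨ ^-monoʳ-≤ 2 u≤lv ⟩
    2 ^ (l * suc d-1)  ≡⟨ ^-*-assoc 2 l (suc d-1) ⟨
    (2 ^ l) ^ suc d-1  ≤⟨ ^-monoˡ-≤ (suc d-1) 2^l≤n ⟩
    n ^ suc d-1        ∎))
  where
  open ≤-Reasoning
  n^v<2^u′ : n ^ suc d-1 < 2 ^ u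
  n^v<2^u′ = ι-cancel-< (subst₂ ℚ._<_
    (trans (ℚ.*-identityʳ _) (sym (ι-^ n (suc d-1)))) (sym (ι-^ 2 u)) n^v<2^u)
upper-log₂⇒> n l 2^l≤n (mkℚ -[1+ u ] d-1 _) (inj₂ n^v2^u<1) rewrite /1≡ι n =
  contradiction lt (≤⇒≯ (*-mono-≤ (m^n>0 n {{n≢0}} (suc d-1)) (m^n>0 2 (suc u))))
  where
  n≢0 : NonZero n
  n≢0 = >-nonZero (≤-trans (m^n>0 2 l) 2^l≤n)
  lt : n ^ suc d-1 * 2 ^ suc u < 1
  lt = ι-cancel-< (subst (ℚ._< 1ℚ)
    (sym (trans (ι-* (n ^ suc d-1) _) (cong₂ ℚ._*_ (ι-^ n (suc d-1)) (ι-^ 2 (suc u))))) n^v2^u<1)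

-- For `s` = u/v > e, `q < a` would yield the cycle n^u < q^v ≤ a^v ≤ n^(ev) ≤ n^u. A negative `s`
-- cannot exceed `e`.
PowerBelow⇒≮ : ∀ n e a → .{{NonZero n}} → a ≤ n ^ e → ∀ s q → ι e ℚ.< s → PowerBelow n s q → ¬ (q ℚ.< ι a)
PowerBelow⇒≮ n e a a≤n^e (mkℚ -[1+ u ] d-1 _) q e<s _ _ = ι≮neg e e<s
PowerBelow⇒≮ n e a a≤n^e (mkℚ (+ u) d-1 _) q e<s (0<q , n^u<q^v) q<a rewrite /1≡ι n =
  <⇒≱ (ι-cancel-< ιn^u<ιa^v) (begin
    a ^ v        ≤⟨ ^-monoˡ-≤ v a≤n^e ⟩
    (n ^ e) ^ v  ≡⟨ ^-*-assoc n e v ⟩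
    n ^ (e * v)  ≤⟨ ^-monoʳ-≤ n (<⇒≤ (ι<⇒ e e<s)) ⟩
    n ^ u        ∎)
  where
  v = suc d-1
  instance
    q-nonNeg : ℚ.NonNegative q
    q-nonNeg = ℚ.nonNegative (ℚ.<⇒≤ 0<q)
  ιn^u<ιa^v : ι (n ^ u) ℚ.< ι (a ^ v)
  ιn^u<ιa^v = begin-strict
    ι (n ^ u)          ≡⟨ ι-^ n u ⟩
    ι n ^ℚ u           <⟨ n^u<q^v ⟩
    q ^ℚ v ℚ.* 1ℚ      ≡⟨ ℚ.*-identityʳ (q ^ℚ v) ⟩
    q ^ℚ v             ≤⟨ ^ℚ-monoˡ-≤ v (ℚ.<⇒≤ q<a) ⟩
    ι a ^ℚ v           ≡⟨ ι-^ a v ⟨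
    ι (a ^ v)          ∎
    where open ℚ.≤-Reasoning
  open ≤-Reasoning

-- Of the four corners of the interval product the corner `b * d` suffices: `p * q ≤ p * d ≤ b * d`,
-- by nonnegativity.
upper-product⇒> : ∀ x y {p q} → .{{ℚ.NonNegative p}} → .{{ℚ.NonNegative q}} →
  (∀ b → upper x b → p ℚ.≤ b) → (∀ d → upper y d → q ℚ.≤ d) →
  ∀ s → upper (x *ᶜ y) s → p ℚ.* q ℚ.< s
upper-product⇒> x y {p} {q} p≤ q≤ s (a , b , c , d , _ , x<b , _ , y<d , max<s) = begin-strict
  p ℚ.* q                    ≤⟨ ℚ.*-monoˡ-≤-nonNeg p (q≤ d y<d) ⟩
  p ℚ.* d                    ≤⟨ ℚ.*-monoʳ-≤-nonNeg d {{d-nonNeg}} (p≤ b x<b) ⟩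
  b ℚ.* d                    ≤⟨ ℚ.p≤q⊔p (b ℚ.* c) (b ℚ.* d) ⟩
  b ℚ.* c ℚ.⊔ b ℚ.* d        ≤⟨ ℚ.p≤q⊔p (a ℚ.* c ℚ.⊔ a ℚ.* d) _ ⟩
  (a ℚ.* c ℚ.⊔ a ℚ.* d) ℚ.⊔ (b ℚ.* c ℚ.⊔ b ℚ.* d) <⟨ max<s ⟩
  s                          ∎
  where
  open ℚ.≤-Reasoning
  d-nonNeg : ℚ.NonNegative d
  d-nonNeg = ℚ.nonNegative (ℚ.≤-trans (ℚ.nonNegative⁻¹ q) (q≤ d y<d))

upper-sum⇒> : ∀ p q b → upper (fromℚ p +ᶜ fromℚ q) b → p ℚ.+ q ℚ.< b
upper-sum⇒> p q b (a , c , p<a , q<c , a+c<b) = ℚ.<-trans (ℚ.+-mono-< p<a q<c) a+c<b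

fromℚ-isDedekind : ∀ p → IsDedekind (fromℚ p)
fromℚ-isDedekind p = record
  { lower-inhabited = p ℚ.- 1ℚ , subst (p ℚ.- 1ℚ ℚ.<_) (ℚ.+-identityʳ p) (ℚ.+-monoʳ-< p (ℚ.negative⁻¹ (ℚ.- 1ℚ)))
  ; upper-inhabited = p ℚ.+ 1ℚ , subst (ℚ._< p ℚ.+ 1ℚ) (ℚ.+-identityʳ p) (ℚ.+-monoʳ-< p (ℚ.positive⁻¹ 1ℚ))
  ; lower-rounded   = λ q → mk⇔ (λ q<p → ℚ.<-dense q<p) (λ (_ , q<r , r<p) → ℚ.<-trans q<r r<p)
  ; upper-rounded   = λ q → mk⇔ (λ p<q → let r , p<r , r<q = ℚ.<-dense p<q in r , r<q , p<r)
                               (λ (_ , r<q , p<r) → ℚ.<-trans p<r r<q)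
  ; disjoint        = λ q (q<p , p<q) → ℚ.<-asym q<p p<q
  ; located         = located
  }
  where
  located : ∀ q r → q ℚ.< r → _
  located q r q<r with q ℚ.<? p
  ... | yes q<p = inj₁ q<p
  ... | no  q≮p = inj₂ (ℚ.≤-<-trans (ℚ.≮⇒≥ q≮p) q<r)

fromℚ-ℝ : ℚ → ℝ
fromℚ-ℝ p = record { cut = fromℚ p ; isDedekind = fromℚ-isDedekind p }

↧ₙ*p≡↥p : ∀ u d-1 .(c : Coprime u (suc d-1)) → ι (suc d-1) ℚ.* mkℚ (+ u) d-1 c ≡ ι u
↧ₙ*p≡↥p u d-1 c = ℚ.toℚᵘ-injective (begin
  ℚ.toℚᵘ (ι (suc d-1) ℚ.* p)              ≈⟨ ℚ.toℚᵘ-homo-* (ι (suc d-1)) p ⟩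
  mkℚᵘ (+ suc d-1) 0 ℚᵘ.* mkℚᵘ (+ u) d-1  ≈⟨ *≡* eq ⟩
  mkℚᵘ (+ u) 0                            ∎)
  where
  open import Relation.Binary.Reasoning.Setoid ℚᵘ.≃-setoid
  p = mkℚ (+ u) d-1 c
  eq : (+ suc d-1 ℤ.* + u) ℤ.* + 1 ≡ + u ℤ.* + (1 * suc d-1)
  eq = trans (ℤ.*-identityʳ (+ suc d-1 ℤ.* + u)) (trans (ℤ.*-comm (+ suc d-1) (+ u))
         (cong (λ m → + u ℤ.* + m) (sym (*-identityˡ (suc d-1)))))

archimedean : ∀ c δ → 0ℚ ℚ.< δ → ∃[ N ] ∀ m → N ≤ m → ι c ℚ.< ι m ℚ.* δ
archimedean c δ@(mkℚ -[1+ u ] d-1 _) 0<δ = contradiction 0<δ (ι≮neg 0)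
-- The witness is `suc c` times the denominator of `δ`: multiplied by `δ` it becomes `suc c * u`,
-- and `u ≥ 1` because `δ > 0`.
archimedean c δ@(mkℚ (+ u) d-1 cop) 0<δ = suc c * suc d-1 , λ m N≤m → begin-strict
  ι c                              <⟨ ι-mono-< (≤-trans (≤-reflexive (sym (*-identityʳ (suc c))))
                                                        (*-monoʳ-≤ (suc c) (ι<⇒ 0 0<δ))) ⟩
  ι (suc c * u)                    ≡⟨ ι-* (suc c) u ⟩
  ι (suc c) ℚ.* ι u                ≡⟨ cong (ι (suc c) ℚ.*_) (↧ₙ*p≡↥p u d-1 cop) ⟨
  ι (suc c) ℚ.* (ι (suc d-1) ℚ.* δ) ≡⟨ ℚ.*-assoc (ι (suc c)) (ι (suc d-1)) δ ⟨
  ι (suc c) ℚ.* ι (suc d-1) ℚ.* δ  ≡⟨ cong (ℚ._* δ) (ι-* (suc c) (suc d-1)) ⟨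
  ι (suc c * suc d-1) ℚ.* δ        ≤⟨ ℚ.*-monoʳ-≤-nonNeg δ {{ℚ.nonNegative (ℚ.<⇒≤ 0<δ)}} (ι-mono-≤ N≤m) ⟩
  ι m ℚ.* δ                        ∎
  where open ℚ.≤-Reasoning

-- The error term and the target exponent

1/[1+_] : ℕ → ℚ
1/[1+ l ] = ℚ.1/ ι (suc l)

ε : ℕ → ℚ
ε n = ι 22 ℚ.* 1/[1+ ⌊log₂ n ⌋ ]

ε*[1+⌊log₂n⌋]≡22 : ∀ n → ε n ℚ.* ι (suc ⌊log₂ n ⌋) ≡ ι 22
ε*[1+⌊log₂n⌋]≡22 n = trans (ℚ.*-assoc (ι 22) 1/[1+ l ] (ι (suc l)))
  (trans (cong (ι 22 ℚ.*_) (ℚ.*-inverseˡ (ι (suc l)))) (ℚ.*-identityʳ (ι 22)))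
  where l = ⌊log₂ n ⌋

ε-pos : ∀ n → ℚ.Positive (ε n)
ε-pos n = ℚ.pos*pos⇒pos (ι 22) 1/[1+ l ]
  where l = ⌊log₂ n ⌋

2^m≤n⇒m≤⌊log₂n⌋ : ∀ {m n} → 2 ^ m ≤ n → m ≤ ⌊log₂ n ⌋
2^m≤n⇒m≤⌊log₂n⌋ {m} 2^m≤n = subst (_≤ _) (⌊log₂[2^n]⌋≡n m) (⌊log₂⌋-mono-≤ 2^m≤n)

-- `ε n < δ` amounts to 22 < (l + 1) δ, which the Archimedean bound `N` ensures once l ≥ N, hence
-- once `n ≥ 2 ^ N`.
ε⟶0 : (λ n → fromℚ (ε n)) ⟶ 0ℚ
ε⟶0 δ 0<δ = let N , large = archimedean 22 δ 0<δ in 2 ^ N , λ n 2^N≤n →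
  ℚ.<-trans (subst (ℚ._< 0ℚ) (sym (ℚ.+-identityˡ (ℚ.- δ))) (ℚ.neg-antimono-< 0<δ))
            (ℚ.positive⁻¹ (ε n) {{ε-pos n}}) ,
  subst (ε n ℚ.<_) (sym (ℚ.+-identityˡ δ))
    (ℚ.*-cancelʳ-<-nonNeg (ι (suc ⌊log₂ n ⌋))
      (subst₂ ℚ._<_ (sym (ε*[1+⌊log₂n⌋]≡22 n)) (ℚ.*-comm (ι (suc ⌊log₂ n ⌋)) δ)
        (large (suc ⌊log₂ n ⌋) (m≤n⇒m≤1+n (2^m≤n⇒m≤⌊log₂n⌋ 2^N≤n)))))

-- It suffices that 11 ≤ ε l, that is 11 (l + 1) ≤ 22 l; this is where the 22 comes from, and it
-- needs l ≥ 1, hence `2 ≤ n`.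
⌊log₂n⌋+11≤ : ∀ n → 2 ≤ n → ι (⌊log₂ n ⌋ + 11) ℚ.≤ (1ℚ ℚ.+ ε n) ℚ.* ι ⌊log₂ n ⌋
⌊log₂n⌋+11≤ n 2≤n = begin
  ι (l + 11)                    ≡⟨ ι-+ l 11 ⟩
  ι l ℚ.+ ι 11                  ≤⟨ ℚ.+-monoʳ-≤ (ι l) 11≤εl ⟩
  ι l ℚ.+ ε n ℚ.* ι l           ≡⟨ cong (ℚ._+ ε n ℚ.* ι l) (ℚ.*-identityˡ (ι l)) ⟨
  1ℚ ℚ.* ι l ℚ.+ ε n ℚ.* ι l    ≡⟨ ℚ.*-distribʳ-+ (ι l) 1ℚ (ε n) ⟨
  (1ℚ ℚ.+ ε n) ℚ.* ι l          ∎
  where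
  open ℚ.≤-Reasoning
  l = ⌊log₂ n ⌋
  1≤l : 1 ≤ l
  1≤l = 2^m≤n⇒m≤⌊log₂n⌋ 2≤n
  11[1+l]≤22l : 11 * suc l ≤ 22 * l
  11[1+l]≤22l = ≤-trans (*-monoʳ-≤ 11 (+-monoˡ-≤ l 1≤l)) (≤-reflexive (ring l))
    where
    ring : ∀ l → 11 * (l + l) ≡ 22 * l
    ring = solve-∀
  11≤εl : ι 11 ℚ.≤ ε n ℚ.* ι l
  11≤εl = ℚ.*-cancelʳ-≤-pos (ι (suc l)) (begin
    ι 11 ℚ.* ι (suc l)                ≡⟨ ι-* 11 (suc l) ⟨
    ι (11 * suc l)                    ≤⟨ ι-mono-≤ 11[1+l]≤22l ⟩
    ι (22 * l)                        ≡⟨ ι-* 22 l ⟩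
    ι 22 ℚ.* ι l                      ≡⟨ cong (ℚ._* ι l) (ε*[1+⌊log₂n⌋]≡22 n) ⟨
    ε n ℚ.* ι (suc l) ℚ.* ι l         ≡⟨ ℚ.*-assoc (ε n) _ _ ⟩
    ε n ℚ.* (ι (suc l) ℚ.* ι l)       ≡⟨ cong (ε n ℚ.*_) (ℚ.*-comm (ι (suc l)) (ι l)) ⟩
    ε n ℚ.* (ι l ℚ.* ι (suc l))       ≡⟨ ℚ.*-assoc (ε n) _ _ ⟨
    ε n ℚ.* ι l ℚ.* ι (suc l)         ∎)

-- A failure of `≤ᶜ` provides a rational `q < a` above the real power, with an exponent `s` above (1
-- + ε) log₂ n. Then `s` exceeds l + 11, and `PowerBelow⇒≮` refutes `q < a`.
≤n^[⌊log₂n⌋+11]⇒≤ᶜ : ∀ n → 2 ≤ n → ∀ a → a ≤ n ^ (⌊log₂ n ⌋ + 11) →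
  fromℕ a ≤ᶜ n ^ᶜ ((fromℚ 1ℚ +ᶜ fromℚ (ε n)) *ᶜ log₂ n)
≤n^[⌊log₂n⌋+11]⇒≤ᶜ n 2≤n a a≤ (q , (s , exponent<s , below) , q<a) =
  PowerBelow⇒≮ n (⌊log₂ n ⌋ + 11) a a≤ s q (ℚ.≤-<-trans (⌊log₂n⌋+11≤ n 2≤n)
    (upper-product⇒> (fromℚ 1ℚ +ᶜ fromℚ (ε n)) (log₂ n) {{nn}}
      (λ b p → ℚ.<⇒≤ (upper-sum⇒> 1ℚ (ε n) b p))
      (λ d p → ℚ.<⇒≤ (upper-log₂⇒> n ⌊log₂ n ⌋ (2^⌊log₂n⌋≤n n) d p)) s exponent<s)) below
    (subst (q ℚ.<_) (/1≡ι a) q<a)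
  where
  instance
    n≢0 : NonZero n
    n≢0 = >-nonZero (≤-trans (s≤s z≤n) 2≤n)
  nn : ℚ.NonNegative (1ℚ ℚ.+ ε n)
  nn = ℚ.nonNeg+nonNeg⇒nonNeg 1ℚ (ε n) {{ℚ.pos⇒nonNeg (ε n) {{ε-pos n}}}}

-- Probability of the good graphs

ι2^n*rowWeight≡1 : ∀ (r : Vec Bool n) →
  ι (2 ^ n) ℚ.* Vec.foldr (λ _ → ℚ) (λ b w → edgeWeight ½ b ℚ.* w) 1ℚ r ≡ 1ℚ
ι2^n*rowWeight≡1 []                = refl
ι2^n*rowWeight≡1 {suc n} (b ∷ r) = trans (cong (ℚ._* (edgeWeight ½ b ℚ.* w)) (ι-* 2 (2 ^ n)))
  (trans (interchange (ι 2) (ι (2 ^ n)) (edgeWeight ½ b) w)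
         (trans (cong₂ ℚ._*_ (half b) (ι2^n*rowWeight≡1 r)) (ℚ.*-identityˡ 1ℚ)))
  where
  w = Vec.foldr (λ _ → ℚ) (λ b w → edgeWeight ½ b ℚ.* w) 1ℚ r
  half : ∀ b → ι 2 ℚ.* edgeWeight ½ b ≡ 1ℚ
  half true  = refl
  half false = refl

-- At edge probability ½ the measure is uniform: each edge or non-edge has weight ½, which a factor
-- 2 cancels.
ι2^pairs*weight≡1 : ∀ (g : Graph n) → ι (2 ^ pairs n) ℚ.* weight ½ g ≡ 1ℚ
ι2^pairs*weight≡1 []                = refl
ι2^pairs*weight≡1 {suc n} (r ∷ g) =
  trans (cong (ℚ._* (w ℚ.* weight ½ g))
              (trans (cong ι (^-distribˡ-+-* 2 n (pairs n))) (ι-* (2 ^ n) (2 ^ pairs n))))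
  (trans (interchange (ι (2 ^ n)) (ι (2 ^ pairs n)) w (weight ½ g))
         (trans (cong₂ ℚ._*_ (ι2^n*rowWeight≡1 r) (ι2^pairs*weight≡1 g)) (ℚ.*-identityˡ 1ℚ)))
  where
  w = Vec.foldr (λ _ → ℚ) (λ b w → edgeWeight ½ b ℚ.* w) 1ℚ r

-- The bridge from counting to probability: scaled by the number of graphs, a mass becomes a
-- cardinality.
ι2^pairs*mass : ∀ (B : Graph n → Bool) → ι (2 ^ pairs n) ℚ.* mass ½ B ≡ ι (∑ (graphs n) (𝟙 ∘ B))
ι2^pairs*mass {n} B = go (graphs n)
  where
  open ≡-Reasoning
  T = ι (2 ^ pairs n)
  f : Graph n → ℚ
  f g = if B g then weight ½ g else 0ℚ
  single : ∀ g → T ℚ.* f g ≡ ι (𝟙 (B g))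
  single g with B g
  ... | true  = ι2^pairs*weight≡1 g
  ... | false = ℚ.*-zeroʳ T
  go : ∀ gs → T ℚ.* sumℚ (map f gs) ≡ ι (∑ gs (𝟙 ∘ B))
  go []       = ℚ.*-zeroʳ T
  go (g ∷ gs) = begin
    T ℚ.* (f g ℚ.+ sumℚ (map f gs))              ≡⟨ ℚ.*-distribˡ-+ T (f g) _ ⟩
    T ℚ.* f g ℚ.+ T ℚ.* sumℚ (map f gs)          ≡⟨ cong₂ ℚ._+_ (single g) (go gs) ⟩
    ι (𝟙 (B g)) ℚ.+ ι (∑ gs (𝟙 ∘ B))             ≡⟨ ι-+ (𝟙 (B g)) _ ⟨
    ι (𝟙 (B g) + ∑ gs (𝟙 ∘ B))                   ∎

ι-pos : ∀ m .{{_ : NonZero m}} → ℚ.Positive (ι m)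
ι-pos (suc m) = _

module _ (n m : ℕ) (n≤2^m : n ≤ 2 ^ m) where

  private
    instance
      T-pos : ℚ.Positive (ι (2 ^ pairs n))
      T-pos = ι-pos (2 ^ pairs n) {{m^n≢0 2 (pairs n)}}
    T M L : ℚ
    T = ι (2 ^ pairs n)
    M = mass ½ (small n m)
    L = ι (∑ (graphs n) (λ g → 𝟙 (not (small n m g))))

    T*M+L≡T : T ℚ.* M ℚ.+ L ≡ T
    T*M+L≡T = trans (cong (ℚ._+ L) (ι2^pairs*mass (small n m)))
      (trans (sym (ι-+ (∑ (graphs n) (𝟙 ∘ small n m)) _))
             (cong ι (trans (∑-complement (small n m) (graphs n)) (∣graphs∣ n))))

    L*n≤T*2 : L ℚ.* ι n ℚ.≤ T ℚ.* ι 2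
    L*n≤T*2 = subst₂ ℚ._≤_ (trans (ι-* n _) (ℚ.*-comm (ι n) L))
      (trans (ι-* 2 (2 ^ pairs n)) (ℚ.*-comm (ι 2) T))
      (ι-mono-≤ (large-rare m n n≤2^m))

  -- From T M + L = T and L ≤ 2T/n < T δ it follows that T (1 - δ) < T M, and the positive `T`
  -- cancels.
  small-likely : ∀ δ → ι 2 ℚ.< ι n ℚ.* δ → 1ℚ ℚ.- δ ℚ.< mass ½ (small n m)
  small-likely δ 2<nδ = ℚ.*-cancelˡ-<-nonNeg T (begin-strict
    T ℚ.* (1ℚ ℚ.- δ)                         ≡⟨ ring₁ T δ ⟩
    T ℚ.- T ℚ.* δ                            ≡⟨ cong (ℚ._- T ℚ.* δ) T*M+L≡T ⟨
    T ℚ.* M ℚ.+ L ℚ.- T ℚ.* δ                ≡⟨ ring₂ (T ℚ.* M) L (T ℚ.* δ) ⟩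
    T ℚ.* M ℚ.- T ℚ.* δ ℚ.+ L                <⟨ ℚ.+-monoʳ-< (T ℚ.* M ℚ.- T ℚ.* δ) L<Tδ ⟩
    T ℚ.* M ℚ.- T ℚ.* δ ℚ.+ T ℚ.* δ          ≡⟨ ring₃ (T ℚ.* M) (T ℚ.* δ) ⟩
    T ℚ.* M                                  ∎)
    where
    open ℚ.≤-Reasoning
    open +-*-Solver
    L<Tδ : L ℚ.< T ℚ.* δ
    L<Tδ = ℚ.*-cancelʳ-<-nonNeg (ι n) (begin-strict
      L ℚ.* ι n               ≤⟨ L*n≤T*2 ⟩
      T ℚ.* ι 2               <⟨ ℚ.*-monoʳ-<-pos T 2<nδ ⟩
      T ℚ.* (ι n ℚ.* δ)       ≡⟨ cong (T ℚ.*_) (ℚ.*-comm (ι n) δ) ⟩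
      T ℚ.* (δ ℚ.* ι n)       ≡⟨ ℚ.*-assoc T δ (ι n) ⟨
      T ℚ.* δ ℚ.* ι n         ∎)
    ring₁ : ∀ t d → t ℚ.* (1ℚ ℚ.- d) ≡ t ℚ.- t ℚ.* d
    ring₁ = solve 2 (λ t d → t :* (con 1ℚ :- d) := t :- t :* d) refl
    ring₂ : ∀ a l d → a ℚ.+ l ℚ.- d ≡ a ℚ.- d ℚ.+ l
    ring₂ = solve 3 (λ a l d → a :+ l :- d := a :- d :+ l) refl
    ring₃ : ∀ a d → a ℚ.- d ℚ.+ d ≡ a
    ring₃ = solve 2 (λ a d → a :- d :+ d := a) refl

-- Convergence of the probabilities to 1

mass-⊤≤1 : ∀ n → mass {n} ½ (λ _ → true) ℚ.≤ 1ℚ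
mass-⊤≤1 n = ℚ.*-cancelˡ-≤-pos (ι (2 ^ pairs n)) {{ι-pos (2 ^ pairs n) {{m^n≢0 2 (pairs n)}}}}
  (ℚ.≤-reflexive (trans (ι2^pairs*mass {n} (λ _ → true))
    (trans (cong ι (∣graphs∣ n)) (sym (ℚ.*-identityʳ _)))))

proposition1p6 : Σ (ℕ → ℝ) λ ε →
    ((λ n → cut (ε n)) ⟶ 0ℚ) ×
    ((λ n → Pr n ½ (λ G → fromℕ (π G) ≤ᶜ n ^ᶜ ((fromℚ 1ℚ +ᶜ cut (ε n)) *ᶜ log₂ n))) ⟶ 1ℚ)
proposition1p6 = fromℚ-ℝ ∘ ε , ε⟶0 , λ δ 0<δ →
  let N , large = archimedean 2 δ 0<δ in
  -- The bound on `π` needs `n ≥ 2`; `N` makes 2 < n δ.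
  2 ⊔ N , λ n 2⊔N≤n →
    -- Lower side: `small` is a decidable event inside the target event. The choice m = l + 1
    -- ensures n ≤ 2^m.
    ( small n (suc ⌊log₂ n ⌋)
    , (λ g is-small → let 2≤n = m⊔n≤o⇒m≤o 2 N 2⊔N≤n in
        ≤n^[⌊log₂n⌋+11]⇒≤ᶜ n 2≤n (π g) (small⇒π≤ n 2≤n g (≤ᵇ⇒≤ _ _ (Equivalence.from Bool.T-≡ is-small))))
    , small-likely n (suc ⌊log₂ n ⌋) (<⇒≤ (n<2^[1+⌊log₂n⌋] n)) δ (large n (m⊔n≤o⇒n≤o 2 N 2⊔N≤n)) )
    -- Upper side: the full event covers the target event and has mass at most 1 < 1 + δ.
    , (λ _ → true) , (λ _ _ → refl)
    , ℚ.≤-<-trans (mass-⊤≤1 n) (subst (ℚ._< 1ℚ ℚ.+ δ) (ℚ.+-identityʳ 1ℚ) (ℚ.+-monoʳ-< 1ℚ 0<δ))
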